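{- Let $n\ge 1$ and let $\pi,\sigma\in\mathfrak{B}_n$ be bigrassmannian permutations with length vectors $(\ell_1(\pi),\ell_2(\pi),\ell_3(\pi),\ell_4(\pi))$ and $(\ell_1(\sigma),\ell_2(\sigma),\ell_3(\sigma),\ell_4(\sigma))$. The following are equivalent: (1) $\pi\le\sigma$ in the Bruhat order; (2) $\ell_1(\pi)\ge\ell_1(\sigma)$, $\ell_4(\pi)\ge\ell_4(\sigma)$, $\ell_2(\pi)\le\ell_2(\sigma)$ and $\ell_3(\pi)\le\ell_3(\sigma)$.
   Context: $\mathfrak{S}_n$ is the set of permutations of $[n]=\{1,\dots,n\}$, written in one-line notation $\omega(1)\cdots\omega(n)$. A reduction of $\omega\in\mathfrak{S}_n$ is a permutation obtained by interchanging $\omega(i)$ and $\omega(j)$ for some $i<j$ with $\omega(i)>\omega(j)$. Bruhat order: $\pi\le\sigma$ if there is a (possibly trivial) chain $\sigma=\omega_1\to\cdots\to\omega_s=\pi$ with each $\omega_t$ a reduction of $\omega_{t-1}$. A permutation $\omega\in\mathfrak{S}_n$ is bigrassmannian (BG) if each of $\omega$ and $\omega^{ -1}$ has exactly one descent (an index $i\in[n-1]$ with $\omega(i)>\omega(i+1)$, respectively $\omega^{ -1}(i)>\omega^{ -1}(i+1)$); $\mathfrak{B}_n$ is the set of BG permutations in $\mathfrak{S}_n$. Equivalently, $\omega\in\mathfrak{B}_n$ iff there is a (unique) triple $0\le a<b<c\le n$ with $\omega=1\cdots a\,(b+1)\cdots c\,(a+1)\cdots b\,(c+1)\cdots n$.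 The length vector of such an element is $(\ell_1,\ell_2,\ell_3,\ell_4)=(a+1,\,b-a,\,c-b,\,n+1-c)$. -}

module Defs where

open import Data.Empty using (⊥; ⊥-elim)
open import Data.Fin using (Fin; toℕ; fromℕ<; _<_)
open import Data.Fin.Permutation
  using (Permutation′; _⟨$⟩ʳ_; _⟨$⟩ˡ_; _≈_; _∘ₚ_; flip; transpose; inverseˡ; inverseʳ)
open import Data.Fin.Properties using (toℕ-injective; toℕ-fromℕ<; toℕ<n)
open import Data.Nat as ℕ using (ℕ; zero; suc; _+_; _∸_; _≤_; s≤s; s≤s⁻¹)
open import Data.Nat.Properties
open import Data.Product using (∃; ∃₂; ∃!; _×_; _,_)
open import Data.Sum using (_⊎_; inj₁; inj₂)
open import Relation.Binary.Construct.Closure.ReflexiveTransitive using (Star)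
open import Relation.Binary.Definitions using (tri<; tri≈; tri>)
open import Relation.Binary.PropositionalEquality
  using (_≡_; _≢_; refl; sym; trans; cong; subst; subst₂; module ≡-Reasoning)

-- Permutations of [n] are permutations of Fin n: the index i : Fin n stands for
-- the element toℕ i + 1 of [n], both as a position and as a value.

private
  variable
    n : ℕ

-- transpose i j ∘ₚ ω sends k to ω ((i j) k), so it interchanges the entries of
-- the one-line notation of ω in positions i and j.
_⟶_ : Permutation′ n → Permutation′ n → Set
ω ⟶ ω′ = ∃₂ λ i j →
  i < j × ω ⟨$⟩ʳ j < ω ⟨$⟩ʳ i × ω′ ≈ (transpose i j ∘ₚ ω)

-- Equality of permutations is the pointwise relation _≈_, so the end of the chain
-- is compared with π up to _≈_; this matters for the trivial chain.
_≤ᴮ_ : Permutation′ n → Permutation′ n → Set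
π ≤ᴮ σ = ∃ λ ω → Star _⟶_ σ ω × ω ≈ π

infix 4 _⟶_ _≤ᴮ_

Descent : Permutation′ n → Fin n → Set
Descent ω i = ∃ λ j → toℕ j ≡ suc (toℕ i) × ω ⟨$⟩ʳ j < ω ⟨$⟩ʳ i

IsBigrassmannian : Permutation′ n → Set
IsBigrassmannian ω = ∃! _≡_ (Descent ω) × ∃! _≡_ (Descent (flip ω))

record 𝔅 (n : ℕ) : Set where
  field
    perm           : Permutation′ n
    bigrassmannian : IsBigrassmannian perm

open 𝔅 public

-- The one-line notation of ω is
--   1 ⋯ a (b+1) ⋯ c (a+1) ⋯ b (c+1) ⋯ n,
-- given by its four blocks, which occupy the (0-based) positions [0, a),
-- [a, a+(c-b)), [a+(c-b), c) and [c, n). On the second block ω(i) = i + (b - a)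
-- and on the third ω(i) = i - (c - b); both are stated without subtraction.
record BlockForm {n : ℕ} (ω : Permutation′ n) : Set where
  field
    a b c  : ℕ
    a<b    : a ℕ.< b
    b<c    : b ℕ.< c
    c≤n    : c ≤ n
    block₁ : ∀ i → toℕ i ℕ.< a → toℕ (ω ⟨$⟩ʳ i) ≡ toℕ i
    block₂ : ∀ i → a ≤ toℕ i → toℕ i ℕ.< a + (c ∸ b) →
             toℕ (ω ⟨$⟩ʳ i) + a ≡ toℕ i + b
    block₃ : ∀ i → a + (c ∸ b) ≤ toℕ i → toℕ i ℕ.< c →
             toℕ (ω ⟨$⟩ʳ i) + c ≡ toℕ i + b
    block₄ : ∀ i → c ≤ toℕ i → toℕ (ω ⟨$⟩ʳ i) ≡ toℕ i

-- The triple (a, b, c) exists for every bigrassmannian permutation (blockForm) and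
-- is unique (blockForm-unique), so the length vector below is well defined.

module _ (ω : Permutation′ n) (d : Fin n)
         (unique : ∀ {i} → Descent ω i → d ≡ i) where

  private
    adjacent : ∀ i j → toℕ j ≡ suc (toℕ i) → toℕ i ≢ toℕ d → ω ⟨$⟩ʳ i < ω ⟨$⟩ʳ j
    adjacent i j j≡1+i i≢d with <-cmp (toℕ (ω ⟨$⟩ʳ i)) (toℕ (ω ⟨$⟩ʳ j))
    ... | tri< lt _ _ = lt
    ... | tri> _ _ gt = ⊥-elim (i≢d (sym (cong toℕ (unique (j , j≡1+i , gt)))))
    ... | tri≈ _ eq _ = ⊥-elim (1+n≢n (trans (sym j≡1+i) (cong toℕ (sym i≡j))))
      where
      i≡j : i ≡ j
      i≡j = trans (sym (inverseˡ ω))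
                  (trans (cong (ω ⟨$⟩ˡ_) (toℕ-injective eq)) (inverseˡ ω))

    mono : ∀ k i j → toℕ j ≡ suc (toℕ i + k) →
           toℕ j ≤ toℕ d ⊎ toℕ d ℕ.< toℕ i → ω ⟨$⟩ʳ i < ω ⟨$⟩ʳ j
    mono zero i j eq side = adjacent i j eq′ (i≢d side)
      where
      eq′ : toℕ j ≡ suc (toℕ i)
      eq′ = trans eq (cong suc (+-identityʳ _))
      i≢d : toℕ j ≤ toℕ d ⊎ toℕ d ℕ.< toℕ i → toℕ i ≢ toℕ d
      i≢d (inj₁ j≤d) i≡d = <-irrefl i≡d (subst (_≤ toℕ d) eq′ j≤d)
      i≢d (inj₂ d<i) i≡d = <-irrefl (sym i≡d) d<i
    mono (suc k) i j eq side =
      <-trans (mono k i h h≡ (side₁ side)) (adjacent h j j≡1+h (h≢d side))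
      where
      j≡ : toℕ j ≡ suc (suc (toℕ i + k))
      j≡ = trans eq (cong suc (+-suc (toℕ i) k))
      bound : suc (toℕ i + k) ℕ.< n
      bound = <-trans (n<1+n _) (subst (ℕ._< n) j≡ (toℕ<n j))
      h : Fin n
      h = fromℕ< bound
      h≡ : toℕ h ≡ suc (toℕ i + k)
      h≡ = toℕ-fromℕ< bound
      j≡1+h : toℕ j ≡ suc (toℕ h)
      j≡1+h = trans j≡ (cong suc (sym h≡))
      h<j : toℕ h ℕ.< toℕ j
      h<j = ≤-reflexive (sym j≡1+h)
      i<h : toℕ i ℕ.< toℕ h
      i<h = subst (toℕ i ℕ.<_) (sym h≡) (s≤s (m≤m+n _ k))
      side₁ : toℕ j ≤ toℕ d ⊎ toℕ d ℕ.< toℕ i → toℕ h ≤ toℕ d ⊎ toℕ d ℕ.< toℕ i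
      side₁ (inj₁ j≤d) = inj₁ (≤-trans (<⇒≤ h<j) j≤d)
      side₁ (inj₂ d<i) = inj₂ d<i
      h≢d : toℕ j ≤ toℕ d ⊎ toℕ d ℕ.< toℕ i → toℕ h ≢ toℕ d
      h≢d (inj₁ j≤d) = <⇒≢ (<-≤-trans h<j j≤d)
      h≢d (inj₂ d<i) h≡d = <⇒≢ (<-trans d<i i<h) (sym h≡d)

  increasing : ∀ {i j} → toℕ j ≤ toℕ d ⊎ toℕ d ℕ.< toℕ i →
               i < j → ω ⟨$⟩ʳ i < ω ⟨$⟩ʳ j
  increasing {i} {j} side i<j = mono _ i j (sym (m+[n∸m]≡n i<j)) side

private
  module Blocks (ω : Permutation′ n) (d d′ e e′ : Fin n)
    (d′≡ : toℕ d′ ≡ suc (toℕ d)) (ωd′<ωd : ω ⟨$⟩ʳ d′ < ω ⟨$⟩ʳ d)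
    (uniqueᵈ : ∀ {i} → Descent ω i → d ≡ i)
    (e′≡ : toℕ e′ ≡ suc (toℕ e))
    (uniqueᵉ : ∀ {i} → Descent (flip ω) i → e ≡ i)
    where

    f g : Fin n → Fin n
    f = ω ⟨$⟩ʳ_
    g = ω ⟨$⟩ˡ_

    f-inc : ∀ {i j} → toℕ j ≤ toℕ d ⊎ toℕ d ℕ.< toℕ i → i < j → f i < f j
    f-inc = increasing ω d uniqueᵈ

    g-inc : ∀ {i j} → toℕ j ≤ toℕ e ⊎ toℕ e ℕ.< toℕ i → i < j → g i < g j
    g-inc = increasing (flip ω) e uniqueᵉ

    g-inj : ∀ {u v} → g u ≡ g v → u ≡ v
    g-inj eq = trans (sym (inverseʳ ω)) (trans (cong f eq) (inverseʳ ω))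

    g-reflects : ∀ {i j} → toℕ (f j) ≤ toℕ e ⊎ toℕ e ℕ.< toℕ (f i) → f i < f j → i < j
    g-reflects side lt = subst₂ _<_ (inverseˡ ω) (inverseˡ ω) (g-inc side lt)

    α x : ℕ
    α = toℕ (f d′)
    x = toℕ (f d)

    d<d′ : d < d′
    d<d′ = ≤-reflexive (sym d′≡)

    α≤e : α ≤ toℕ e
    α≤e = ≮⇒≥ λ e<α → <-asym d<d′ (g-reflects (inj₂ e<α) ωd′<ωd)

    e<x : toℕ e ℕ.< x
    e<x = ≰⇒> λ x≤e → <-asym d<d′ (g-reflects (inj₁ x≤e) ωd′<ωd)

    g-below : ∀ k v → toℕ v ℕ.< k → toℕ v ℕ.< α → g v ≡ v
    g-below (suc k) v (s≤s v≤k) v<α with <-cmp (toℕ (g v)) (toℕ v)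
    ... | tri≈ _ eq _ = toℕ-injective eq
    ... | tri< lt _ _ =
      g-inj (g-below k (g v) (<-≤-trans lt v≤k) (<-trans lt v<α))
    ... | tri> _ _ gt = ⊥-elim (<⇒≢ fv<v (cong toℕ fv≡v))
      where
      gv≤d : toℕ (g v) ≤ toℕ d
      gv≤d = s≤s⁻¹ (subst (toℕ (g v) ℕ.<_) (trans (cong toℕ (inverseˡ ω)) d′≡)
                      (g-inc (inj₁ α≤e) v<α))
      fv<v : f v < v
      fv<v = subst (f v <_) (inverseʳ ω) (f-inc (inj₁ gv≤d) gt)
      fv≡v : f v ≡ v
      fv≡v = trans (sym (g-below k (f v) (<-≤-trans fv<v v≤k) (<-trans fv<v v<α)))
                   (inverseˡ ω)

    g-above : ∀ k v → n ≤ toℕ v + k → x ℕ.< toℕ v → g v ≡ v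
    g-above zero v n≤ _ =
      ⊥-elim (<⇒≱ (toℕ<n v) (subst (n ≤_) (+-identityʳ _) n≤))
    g-above (suc k) v n≤ x<v with <-cmp (toℕ (g v)) (toℕ v)
    ... | tri≈ _ eq _ = toℕ-injective eq
    ... | tri> _ _ gt =
      g-inj (g-above k (g v)
        (≤-trans (subst (n ≤_) (+-suc _ k) n≤) (+-monoˡ-≤ k gt)) (<-trans x<v gt))
    ... | tri< lt _ _ = ⊥-elim (<⇒≢ v<fv (cong toℕ (sym fv≡v)))
      where
      d<gv : d < g v
      d<gv = subst (_< g v) (inverseˡ ω) (g-inc (inj₂ e<x) x<v)
      v<fv : v < f v
      v<fv = subst (_< f v) (inverseʳ ω) (f-inc (inj₂ d<gv) lt)
      fv≡v : f v ≡ v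
      fv≡v = trans (sym (g-above k (f v)
                     (≤-trans (subst (n ≤_) (+-suc _ k) n≤) (+-monoˡ-≤ k v<fv))
                     (<-trans x<v v<fv)))
                   (inverseˡ ω)

    below : ∀ v → toℕ v ℕ.< α → g v ≡ v
    below v = g-below _ v (n<1+n _)

    above : ∀ v → x ℕ.< toℕ v → g v ≡ v
    above v = g-above n v (m≤n+m n _)

    swap-fix : ∀ {v} → g v ≡ v → f v ≡ v
    swap-fix eq = trans (cong f (sym eq)) (inverseʳ ω)

    step : ∀ i j → toℕ j ≡ suc (toℕ i) → f i < f j →
           toℕ (f j) ≤ toℕ e ⊎ toℕ e ℕ.< toℕ (f i) → toℕ (f j) ≡ suc (toℕ (f i))
    step i j j≡ fi<fj side with m≤n⇒m<n∨m≡n fi<fj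
    ... | inj₂ eq = sym eq
    ... | inj₁ lt = ⊥-elim (<⇒≱ gv<j (subst (_≤ toℕ (g v)) (sym j≡) i<gv))
      where
      bound : suc (toℕ (f i)) ℕ.< n
      bound = <-trans lt (toℕ<n (f j))
      v : Fin n
      v = fromℕ< bound
      v≡ : toℕ v ≡ suc (toℕ (f i))
      v≡ = toℕ-fromℕ< bound
      fi<v : f i < v
      fi<v = ≤-reflexive (sym v≡)
      v<fj : v < f j
      v<fj = subst (ℕ._< toℕ (f j)) (sym v≡) lt
      side₁ : toℕ (f j) ≤ toℕ e ⊎ toℕ e ℕ.< toℕ (f i) → toℕ v ≤ toℕ e ⊎ toℕ e ℕ.< toℕ (f i)
      side₁ (inj₁ p) = inj₁ (≤-trans (<⇒≤ v<fj) p)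
      side₁ (inj₂ p) = inj₂ p
      side₂ : toℕ (f j) ≤ toℕ e ⊎ toℕ e ℕ.< toℕ (f i) → toℕ (f j) ≤ toℕ e ⊎ toℕ e ℕ.< toℕ v
      side₂ (inj₁ p) = inj₁ p
      side₂ (inj₂ p) = inj₂ (<-trans p fi<v)
      i<gv : i < g v
      i<gv = subst (_< g v) (inverseˡ ω) (g-inc (side₁ side) fi<v)
      gv<j : g v < j
      gv<j = subst (g v <_) (inverseˡ ω) (g-inc (side₂ side) v<fj)

    pred : ∀ m k (i : Fin n) → toℕ i ≡ m + suc k →
           ∃ λ (h : Fin n) → toℕ h ≡ m + k × toℕ i ≡ suc (toℕ h)
    pred m k i eq = fromℕ< bound , toℕ-fromℕ< bound , trans i≡ (cong suc (sym (toℕ-fromℕ< bound)))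
      where
      i≡ : toℕ i ≡ suc (m + k)
      i≡ = trans eq (+-suc m k)
      bound : m + k ℕ.< n
      bound = <-trans (n<1+n _) (subst (ℕ._< n) i≡ (toℕ<n i))

    f-high : ∀ i → α ≤ toℕ i → toℕ i ≤ toℕ d → toℕ e ℕ.< toℕ (f i)
    f-high i α≤i i≤d = ≰⇒> λ fi≤e → absurd fi≤e (<-cmp (toℕ (f i)) α)
      where
      absurd : toℕ (f i) ≤ toℕ e → _ → ⊥
      absurd fi≤e (tri< lt _ _) =
        <⇒≱ lt (≤-trans α≤i (≤-reflexive (cong toℕ (trans (sym (inverseˡ ω)) (below (f i) lt)))))
      absurd fi≤e (tri≈ _ eq _) =
        <⇒≱ d<d′ (subst (ℕ._≤ toℕ d) (cong toℕ i≡d′) i≤d)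
        where
        i≡d′ : i ≡ d′
        i≡d′ = trans (sym (inverseˡ ω)) (trans (cong g (toℕ-injective eq)) (inverseˡ ω))
      absurd fi≤e (tri> _ _ gt) =
        <⇒≱ (<-trans d<d′ (g-reflects (inj₁ fi≤e) gt)) i≤d

    f-low : ∀ i → toℕ d ℕ.< toℕ i → toℕ i ≤ x → toℕ (f i) ≤ toℕ e
    f-low i d<i i≤x = ≮⇒≥ λ e<fi → absurd e<fi (<-cmp (toℕ (f i)) x)
      where
      absurd : toℕ e ℕ.< toℕ (f i) → _ → ⊥
      absurd e<fi (tri> _ _ gt) =
        <⇒≱ gt (≤-trans (≤-reflexive (cong toℕ (trans (sym (above (f i) gt)) (inverseˡ ω)))) i≤x)
      absurd e<fi (tri≈ _ eq _) = <⇒≢ d<i (cong toℕ d≡i)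
        where
        d≡i : d ≡ i
        d≡i = trans (sym (inverseˡ ω)) (trans (cong g (toℕ-injective (sym eq))) (inverseˡ ω))
      absurd e<fi (tri< lt _ _) = <-asym d<i (g-reflects (inj₂ e<fi) lt)

    second : ∀ k i → toℕ i ≡ α + k → toℕ i ≤ toℕ d → toℕ (f i) ≡ toℕ e′ + k
    second zero i i≡ i≤d = trans (≤-antisym (≮⇒≥ no) e′≤fi) (sym (+-identityʳ _))
      where
      i≡α : toℕ i ≡ α
      i≡α = trans i≡ (+-identityʳ α)
      e′≤fi : toℕ e′ ≤ toℕ (f i)
      e′≤fi = subst (_≤ toℕ (f i)) (sym e′≡) (f-high i (≤-reflexive (sym i≡α)) i≤d)
      e<e′ : e < e′
      e<e′ = ≤-reflexive (sym e′≡)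
      no : e′ < f i → ⊥
      no e′<fi = <⇒≱ (<-≤-trans (subst (ℕ._< α) (cong toℕ ge′≡e′) ge′<α) α≤e) (<⇒≤ e<e′)
        where
        ge′<α : toℕ (g e′) ℕ.< α
        ge′<α = subst (toℕ (g e′) ℕ.<_) (trans (cong toℕ (inverseˡ ω)) i≡α)
                  (g-inc (inj₂ e<e′) e′<fi)
        ge′≡e′ : g e′ ≡ e′
        ge′≡e′ = g-inj (below (g e′) ge′<α)
    second (suc k) i i≡ i≤d with pred α k i i≡
    ... | h , h≡ , i≡1+h = trans (step h i i≡1+h (f-inc (inj₁ i≤d) h<i)
                             (inj₂ (f-high h (subst (α ≤_) (sym h≡) (m≤m+n α k)) h≤d)))
                           (trans (cong suc (second k h h≡ h≤d)) (sym (+-suc _ k)))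
      where
      h<i : h < i
      h<i = ≤-reflexive (sym i≡1+h)
      h≤d : toℕ h ≤ toℕ d
      h≤d = ≤-trans (<⇒≤ h<i) i≤d

    third : ∀ k i → toℕ i ≡ toℕ d′ + k → toℕ i ≤ x → toℕ (f i) ≡ α + k
    third zero i i≡ i≤x =
      trans (cong (λ j → toℕ (f j)) (toℕ-injective (trans i≡ (+-identityʳ _))))
            (sym (+-identityʳ α))
    third (suc k) i i≡ i≤x with pred (toℕ d′) k i i≡
    ... | h , h≡ , i≡1+h = trans (step h i i≡1+h (f-inc (inj₂ d<h) h<i)
                             (inj₁ (f-low i (<-trans d<h h<i) i≤x)))
                           (trans (cong suc (third k h h≡ (≤-trans (<⇒≤ h<i) i≤x)))
                                  (sym (+-suc α k)))
      where
      h<i : h < i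
      h<i = ≤-reflexive (sym i≡1+h)
      d<h : d < h
      d<h = <-≤-trans d<d′ (subst (toℕ d′ ≤_) (sym h≡) (m≤m+n _ k))

    α≤d : α ≤ toℕ d
    α≤d = ≮⇒≥ λ d<α →
      <-asym ωd′<ωd (subst (ℕ._< α) (sym (cong toℕ (swap-fix (below d d<α)))) d<α)

    x+α≡ : x + α ≡ toℕ e′ + toℕ d
    x+α≡ = begin
      x + α                          ≡⟨ cong (_+ α) (second _ d (sym (m+[n∸m]≡n α≤d)) ≤-refl) ⟩
      toℕ e′ + (toℕ d ∸ α) + α       ≡⟨ +-assoc (toℕ e′) _ α ⟩
      toℕ e′ + (toℕ d ∸ α + α)       ≡⟨ cong (toℕ e′ +_) (m∸n+n≡m α≤d) ⟩
      toℕ e′ + toℕ d                 ∎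
      where open ≡-Reasoning

    α+1+x≡ : α + suc x ≡ toℕ e′ + toℕ d′
    α+1+x≡ = begin
      α + suc x             ≡⟨ +-suc α x ⟩
      suc (α + x)           ≡⟨ cong suc (trans (+-comm α x) x+α≡) ⟩
      suc (toℕ e′ + toℕ d)  ≡⟨ +-suc (toℕ e′) (toℕ d) ⟨
      toℕ e′ + suc (toℕ d)  ≡⟨ cong (toℕ e′ +_) d′≡ ⟨
      toℕ e′ + toℕ d′       ∎
      where open ≡-Reasoning

    e′≤x : toℕ e′ ≤ x
    e′≤x = subst (_≤ x) (sym e′≡) e<x

    boundary : α + (suc x ∸ toℕ e′) ≡ toℕ d′
    boundary = begin
      α + (suc x ∸ toℕ e′)          ≡⟨ +-∸-assoc α (m≤n⇒m≤1+n e′≤x) ⟨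
      α + suc x ∸ toℕ e′            ≡⟨ cong (_∸ toℕ e′) α+1+x≡ ⟩
      toℕ e′ + toℕ d′ ∸ toℕ e′      ≡⟨ m+n∸m≡n (toℕ e′) (toℕ d′) ⟩
      toℕ d′                        ∎
      where open ≡-Reasoning

    form : BlockForm ω
    form = record
      { a = α
      ; b = toℕ e′
      ; c = suc x
      ; a<b = subst (α ℕ.<_) (sym e′≡) (s≤s α≤e)
      ; b<c = s≤s e′≤x
      ; c≤n = toℕ<n (f d)
      ; block₁ = λ i i<α → cong toℕ (swap-fix (below i i<α))
      ; block₂ = block₂
      ; block₃ = block₃
      ; block₄ = λ i x<i → cong toℕ (swap-fix (above i x<i))
      }
      where
      open ≡-Reasoning
      block₂ : ∀ i → α ≤ toℕ i → toℕ i ℕ.< α + (suc x ∸ toℕ e′) →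
               toℕ (f i) + α ≡ toℕ i + toℕ e′
      block₂ i α≤i i<p = begin
        toℕ (f i) + α               ≡⟨ cong (_+ α) (second _ i (sym (m+[n∸m]≡n α≤i))
                                         (s≤s⁻¹ (subst (toℕ i ℕ.<_) (trans boundary d′≡) i<p))) ⟩
        toℕ e′ + (toℕ i ∸ α) + α    ≡⟨ +-assoc (toℕ e′) _ α ⟩
        toℕ e′ + (toℕ i ∸ α + α)    ≡⟨ cong (toℕ e′ +_) (m∸n+n≡m α≤i) ⟩
        toℕ e′ + toℕ i              ≡⟨ +-comm (toℕ e′) (toℕ i) ⟩
        toℕ i + toℕ e′              ∎
      block₃ : ∀ i → α + (suc x ∸ toℕ e′) ≤ toℕ i → toℕ i ℕ.< suc x →
               toℕ (f i) + suc x ≡ toℕ i + toℕ e′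
      block₃ i p≤i (s≤s i≤x) = begin
        toℕ (f i) + suc x           ≡⟨ cong (_+ suc x) (third k i (sym (m+[n∸m]≡n d′≤i)) i≤x) ⟩
        α + k + suc x               ≡⟨ cong (_+ suc x) (+-comm α k) ⟩
        k + α + suc x               ≡⟨ +-assoc k α (suc x) ⟩
        k + (α + suc x)             ≡⟨ cong (k +_) (trans α+1+x≡ (+-comm (toℕ e′) _)) ⟩
        k + (toℕ d′ + toℕ e′)       ≡⟨ +-assoc k _ _ ⟨
        k + toℕ d′ + toℕ e′         ≡⟨ cong (_+ toℕ e′) (m∸n+n≡m d′≤i) ⟩
        toℕ i + toℕ e′              ∎
        where
        d′≤i : toℕ d′ ≤ toℕ i
        d′≤i = subst (_≤ toℕ i) boundary p≤i
        k : ℕ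
        k = toℕ i ∸ toℕ d′

blockForm : (ω : Permutation′ n) → IsBigrassmannian ω → BlockForm ω
blockForm ω ((d , (d′ , d′≡ , lt) , uniqueᵈ) , (e , (e′ , e′≡ , _) , uniqueᵉ)) =
  Blocks.form ω d d′ e e′ d′≡ lt uniqueᵈ e′≡ uniqueᵉ

private
  -- The only descent of a block form is at its boundary p | p+1 between the second
  -- and third blocks, where the entry c is followed by a + 1.
  module Boundary (ω : Permutation′ n) (F : BlockForm ω) where
    open BlockForm F

    p : ℕ
    p = a + (c ∸ suc b)

    1+p≡ : suc p ≡ a + (c ∸ b)
    1+p≡ = trans (sym (+-suc a _)) (cong (a +_) (sym (+-∸-assoc 1 b<c)))

    1+p<c : suc p ℕ.< c
    1+p<c = subst (ℕ._< c) (sym 1+p≡)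
              (subst (a + (c ∸ b) ℕ.<_) (m+[n∸m]≡n (<⇒≤ b<c)) (+-monoˡ-< (c ∸ b) a<b))

    1+p<n : suc p ℕ.< n
    1+p<n = <-≤-trans 1+p<c c≤n

    p<n : p ℕ.< n
    p<n = <-trans (n<1+n p) 1+p<n

    i j : Fin n
    i = fromℕ< p<n
    j = fromℕ< 1+p<n

    i≡ : toℕ i ≡ p
    i≡ = toℕ-fromℕ< p<n

    j≡ : toℕ j ≡ suc p
    j≡ = toℕ-fromℕ< 1+p<n

    ωi≡ : suc (toℕ (ω ⟨$⟩ʳ i)) ≡ c
    ωi≡ = +-cancelʳ-≡ a _ _ (begin
      suc (toℕ (ω ⟨$⟩ʳ i) + a)  ≡⟨ cong suc (block₂ i (subst (a ≤_) (sym i≡) (m≤m+n a _))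
                                     (≤-reflexive (trans (cong suc i≡) 1+p≡))) ⟩
      suc (toℕ i + b)           ≡⟨ cong (λ m → suc m + b) i≡ ⟩
      suc p + b                 ≡⟨ cong (_+ b) 1+p≡ ⟩
      a + (c ∸ b) + b           ≡⟨ +-assoc a _ b ⟩
      a + (c ∸ b + b)           ≡⟨ cong (a +_) (m∸n+n≡m (<⇒≤ b<c)) ⟩
      a + c                     ≡⟨ +-comm a c ⟩
      c + a                     ∎)
      where open ≡-Reasoning

    ωj≡ : toℕ (ω ⟨$⟩ʳ j) ≡ a
    ωj≡ = +-cancelʳ-≡ c _ _ (begin
      toℕ (ω ⟨$⟩ʳ j) + c        ≡⟨ block₃ j (≤-reflexive (trans (sym 1+p≡) (sym j≡)))
                                     (subst (ℕ._< c) (sym j≡) 1+p<c) ⟩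
      toℕ j + b                 ≡⟨ cong (_+ b) (trans j≡ 1+p≡) ⟩
      a + (c ∸ b) + b           ≡⟨ +-assoc a _ b ⟩
      a + (c ∸ b + b)           ≡⟨ cong (a +_) (m∸n+n≡m (<⇒≤ b<c)) ⟩
      a + c                     ∎)
      where open ≡-Reasoning

    descent : Descent ω i
    descent = j , trans j≡ (cong suc (sym i≡)) ,
      s≤s⁻¹ (subst₂ ℕ._<_ (sym (cong suc ωj≡)) (sym ωi≡) (≤-<-trans a<b b<c))

blockForm-unique : (ω : Permutation′ n) → IsBigrassmannian ω → (F G : BlockForm ω) →
  BlockForm.a F ≡ BlockForm.a G × BlockForm.b F ≡ BlockForm.b G × BlockForm.c F ≡ BlockForm.c G
blockForm-unique ω ((d , _ , unique) , _) F G = a≡ , b≡ , c≡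
  where
  module F = BlockForm F
  module G = BlockForm G
  module BF = Boundary ω F
  module BG = Boundary ω G
  i≡ : BF.i ≡ BG.i
  i≡ = trans (sym (unique BF.descent)) (unique BG.descent)
  p≡ : suc BF.p ≡ suc BG.p
  p≡ = cong suc (trans (sym BF.i≡) (trans (cong toℕ i≡) BG.i≡))
  j≡ : BF.j ≡ BG.j
  j≡ = toℕ-injective (trans BF.j≡ (trans p≡ (sym BG.j≡)))
  a≡ : F.a ≡ G.a
  a≡ = trans (sym BF.ωj≡) (trans (cong (λ k → toℕ (ω ⟨$⟩ʳ k)) j≡) BG.ωj≡)
  c≡ : F.c ≡ G.c
  c≡ = trans (sym BF.ωi≡) (trans (cong (λ k → suc (toℕ (ω ⟨$⟩ʳ k))) i≡) BG.ωi≡)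
  c∸b≡ : F.c ∸ F.b ≡ F.c ∸ G.b
  c∸b≡ = trans (+-cancelˡ-≡ F.a _ _
    (trans (sym BF.1+p≡) (trans p≡ (trans BG.1+p≡ (cong (_+ (G.c ∸ G.b)) (sym a≡))))))
    (cong (_∸ G.b) (sym c≡))
  b≡ : F.b ≡ G.b
  b≡ = ∸-cancelˡ-≡ (<⇒≤ F.b<c) (subst (G.b ≤_) (sym c≡) (<⇒≤ G.b<c)) c∸b≡

module _ {n : ℕ} (ω : 𝔅 n) where
  open BlockForm (blockForm (perm ω) (bigrassmannian ω))

  ℓ₁ ℓ₂ ℓ₃ ℓ₄ : ℕ
  ℓ₁ = a + 1
  ℓ₂ = b ∸ a
  ℓ₃ = c ∸ b
  ℓ₄ = n + 1 ∸ c

{-# OPTIONS --safe #-}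
-- (1) ⇒ (2): the entries v = σ(i) satisfy bounds such as v ≤ i + ℓ₂ and
-- i ≤ v + ℓ₃, and such bounds survive the sorting of two entries that are out of
-- order; the entries of π at its block boundaries then give the inequalities.
-- (2) ⇒ (1): letting the largest entry of the second block slide to the right
-- past the third block moves one unit of length from ℓ₃ to ℓ₄, and letting the
-- smallest one slide through the places of the third block moves one unit from ℓ₃
-- to ℓ₁. Inversion preserves the Bruhat order and exchanges ℓ₂ with ℓ₃, so units
-- also move from ℓ₂, and these four moves lead from σ to π.
module Submission where

open import Defs
open import Data.Nat using (ℕ; _≤_; _≥_)
open import Data.Product using (_×_)
open import Function.Bundles using (_⇔_)

open import Data.Fin as Fin using (Fin; toℕ; fromℕ<)
open import Data.Fin.Permutation
  using (Permutation′; _⟨$⟩ʳ_; _⟨$⟩ˡ_; _≈_; _∘ₚ_; flip; transpose; inverseˡ; inverseʳ)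
open import Data.Fin.Properties using (toℕ-injective; toℕ-fromℕ<; toℕ<n; _≟_)
open import Data.Nat as ℕ using (zero; suc; _+_; _∸_; _<_; s≤s; z≤n)
open import Data.Nat.Properties hiding (_≟_)
open import Data.Nat.Tactic.RingSolver using (solve-∀)
open import Data.Product using (∃; _,_; proj₁; proj₂)
open import Data.Sum using (inj₁; inj₂)
open import Function using (_∘_)
open import Function.Bundles using (mk⇔)
open import Relation.Binary.Construct.Closure.ReflexiveTransitive using (Star; ε; _◅_; _◅◅_; gmap)
open import Relation.Binary.PropositionalEquality
open import Relation.Nullary using (yes; no; contradiction)
open import Relation.Nullary.Decidable using (dec-true; dec-false)

private
  variable
    n : ℕ
    ω π σ : Permutation′ n

-- Transpositions, and reductions under inversion.

transpose-first : (i j : Fin n) → transpose i j ⟨$⟩ʳ i ≡ j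
transpose-first i j rewrite dec-true (i ≟ i) refl = refl

transpose-second : (i j : Fin n) → transpose i j ⟨$⟩ʳ j ≡ i
transpose-second i j with j ≟ i
... | yes j≡i = j≡i
... | no  _   rewrite dec-true (j ≟ j) refl = refl

transpose-other : {i j l : Fin n} → l ≢ i → l ≢ j → transpose i j ⟨$⟩ʳ l ≡ l
transpose-other {i = i} {j} {l} l≢i l≢j
  rewrite dec-false (l ≟ i) l≢i | dec-false (l ≟ j) l≢j = refl

transpose-rec : (i j : Fin n) (R : Fin n → Fin n → Set) → R i j → R j i →
  (∀ {l} → l ≢ i → l ≢ j → R l l) → ∀ l → R l (transpose i j ⟨$⟩ʳ l)
transpose-rec i j R ij ji other l with l ≟ i
... | yes refl = ij
... | no l≢i with l ≟ j
...   | yes refl = ji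
...   | no l≢j   = other l≢i l≢j

-- Interchanging the values at places `i < j` means, read in the inverse, interchanging the places
-- of these two values; the inequality of places and the inequality of values trade roles.
flip-⟶ : (ω ω′ : Permutation′ n) → ω ⟶ ω′ → flip ω ⟶ flip ω′
flip-⟶ ω ω′ (i , j , i<j , ωj<ωi , ω′≈) =
  ω ⟨$⟩ʳ j , ω ⟨$⟩ʳ i , ωj<ωi ,
  subst₂ Fin._<_ (sym (inverseˡ ω)) (sym (inverseˡ ω)) i<j ,
  λ v → trans (cong (ω′ ⟨$⟩ˡ_) (sym (preimage v))) (inverseˡ ω′)
  where
  ω′-at : ∀ {u l l′} → ω ⟨$⟩ˡ u ≡ l → transpose i j ⟨$⟩ʳ l ≡ l′ →
          ω′ ⟨$⟩ʳ (ω ⟨$⟩ˡ u) ≡ ω ⟨$⟩ʳ l′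
  ω′-at refl refl = ω′≈ _

  preimage : ∀ v → ω′ ⟨$⟩ʳ (ω ⟨$⟩ˡ (transpose (ω ⟨$⟩ʳ j) (ω ⟨$⟩ʳ i) ⟨$⟩ʳ v)) ≡ v
  preimage = transpose-rec (ω ⟨$⟩ʳ j) (ω ⟨$⟩ʳ i) (λ v u → ω′ ⟨$⟩ʳ (ω ⟨$⟩ˡ u) ≡ v)
    (ω′-at (inverseˡ ω) (transpose-first i j))
    (ω′-at (inverseˡ ω) (transpose-second i j))
    (λ v≢ωj v≢ωi → trans
      (ω′-at refl (transpose-other
        (λ eq → v≢ωi (trans (sym (inverseʳ ω)) (cong (ω ⟨$⟩ʳ_) eq)))
        (λ eq → v≢ωj (trans (sym (inverseʳ ω)) (cong (ω ⟨$⟩ʳ_) eq)))))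
      (inverseʳ ω))

-- Conditions on single entries that pass down the Bruhat order.

SortingClosed : (ℕ → ℕ → Set) → Set
SortingClosed P = ∀ {i j u v} → i < j → u < v → P i v → P j u → P i u × P j v

-- Only the two exchanged entries change, and for these `SortingClosed` supplies the condition.
⟶-preserves : (P : ℕ → ℕ → Set) → SortingClosed P → (ω ω′ : Permutation′ n) → ω ⟶ ω′ →
  (∀ i → P (toℕ i) (toℕ (ω ⟨$⟩ʳ i))) → ∀ i → P (toℕ i) (toℕ (ω′ ⟨$⟩ʳ i))
⟶-preserves P closed ω _ (i , j , i<j , ωj<ωi , ω′≈) Pω l =
  subst (P (toℕ l) ∘ toℕ) (sym (ω′≈ l))
    (transpose-rec i j (λ l u → P (toℕ l) (toℕ (ω ⟨$⟩ʳ u)))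
      (proj₁ sorted) (proj₂ sorted) (λ {l} _ _ → Pω l) l)
  where
  sorted : P (toℕ i) (toℕ (ω ⟨$⟩ʳ j)) × P (toℕ j) (toℕ (ω ⟨$⟩ʳ i))
  sorted = closed i<j ωj<ωi (Pω i) (Pω j)

≤ᴮ-preserves : (P : ℕ → ℕ → Set) → SortingClosed P → (π σ : Permutation′ n) → π ≤ᴮ σ →
  (∀ i → P (toℕ i) (toℕ (σ ⟨$⟩ʳ i))) → ∀ i → P (toℕ i) (toℕ (π ⟨$⟩ʳ i))
≤ᴮ-preserves P closed _ _ (_ , ε , ω≈π) Pσ i =
  subst (P (toℕ i) ∘ toℕ) (ω≈π i) (Pσ i)
≤ᴮ-preserves P closed π σ (ω , _◅_ {j = ω₁} step steps , ω≈π) Pσ =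
  ≤ᴮ-preserves P closed π ω₁ (ω , steps , ω≈π) (⟶-preserves P closed σ ω₁ step Pσ)

-- Entries of the one-line notation and their exchange.

-- Places and values are natural numbers, so that arithmetic on them carries no bounds; the witness
-- in `Fin n` supplies these.
Entry : Permutation′ n → ℕ → ℕ → Set
Entry ω i v = ∃ λ l → toℕ l ≡ i × toℕ (ω ⟨$⟩ʳ l) ≡ v

entry-at : (ω : Permutation′ n) (Q : ℕ → ℕ → Set) {i v : ℕ} → Entry ω i v → Q i v →
  ∀ l → toℕ l ≡ i → Q (toℕ l) (toℕ (ω ⟨$⟩ʳ l))
entry-at ω Q (l′ , refl , refl) q l eq with toℕ-injective eq
... | refl = q

entry-flip : (ω : Permutation′ n) {i v : ℕ} → Entry ω i v → Entry (flip ω) v i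
entry-flip ω (l , l≡i , ωl≡v) = ω ⟨$⟩ʳ l , ωl≡v , trans (cong toℕ (inverseˡ ω)) l≡i

swap-entries : (ω : Permutation′ n) {p q u v : ℕ} → p < q → v < u →
  Entry ω p u → Entry ω q v →
  ∃ λ ω′ → ω ⟶ ω′ × Entry ω′ p v × Entry ω′ q u ×
    (∀ {i w} → i ≢ p → i ≢ q → Entry ω i w → Entry ω′ i w)
swap-entries ω p<q v<u (i , refl , refl) (j , refl , refl) =
  transpose i j ∘ₚ ω ,
  (i , j , p<q , v<u , λ _ → refl) ,
  (i , refl , cong (toℕ ∘ (ω ⟨$⟩ʳ_)) (transpose-first i j)) ,
  (j , refl , cong (toℕ ∘ (ω ⟨$⟩ʳ_)) (transpose-second i j)) ,
  λ { l≢i l≢j (l , refl , eq) →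
      l , refl , trans (cong (toℕ ∘ (ω ⟨$⟩ʳ_))
                         (transpose-other (l≢i ∘ cong toℕ) (l≢j ∘ cong toℕ))) eq }

increasing-< : {p : ℕ → ℕ} → (∀ t → p t < p (suc t)) → ∀ {s t} → s < t → p s < p t
increasing-< inc {s} {suc t} (s≤s s≤t) with m≤n⇒m<n∨m≡n s≤t
... | inj₁ s<t  = <-trans (increasing-< inc s<t) (inc t)
... | inj₂ refl = inc t

-- The large entry y travels from place p 0 to place p r, exchanged in turn with the
-- entries x t at the places p (t + 1).
slide : ∀ r (ω : Permutation′ n) (p x : ℕ → ℕ) (y : ℕ) →
  (∀ t → p t < p (suc t)) → (∀ {t} → t < r → x t < y) →
  Entry ω (p 0) y → (∀ {t} → t < r → Entry ω (p (suc t)) (x t)) →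
  ∃ λ ω′ → Star _⟶_ ω ω′ × Entry ω′ (p r) y × (∀ {t} → t < r → Entry ω′ (p t) (x t)) ×
    (∀ {i v} → (∀ {t} → t ≤ r → i ≢ p t) → Entry ω i v → Entry ω′ i v)
slide zero ω p x y inc x<y y-at x-at = ω , ε , y-at , (λ ()) , λ _ e → e
slide (suc r) ω p x y inc x<y y-at x-at
  with swap-entries ω (inc 0) (x<y (s≤s z≤n)) y-at (x-at (s≤s z≤n))
... | ω₁ , step , x₀-at₁ , y-at₁ , frame₁
  with slide r ω₁ (p ∘ suc) (x ∘ suc) y (inc ∘ suc) (x<y ∘ s≤s) y-at₁
         (λ t<r → frame₁ (>⇒≢ (increasing-< inc (s≤s z≤n)))
                         (>⇒≢ (increasing-< inc (s≤s (s≤s z≤n)))) (x-at (s≤s t<r)))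
... | ω₂ , steps , y-at₂ , x-at₂ , frame₂ =
  ω₂ , step ◅ steps , y-at₂ ,
  -- `x 0` already sits at `p 0`, to the left of every place that the rest of the slide touches.
  (λ { {zero}  _         → frame₂ (λ _ → <⇒≢ (increasing-< inc (s≤s z≤n))) x₀-at₁
     ; {suc t} (s≤s t<r) → x-at₂ t<r }) ,
  λ i≢p e → frame₂ (i≢p ∘ s≤s) (frame₁ (i≢p z≤n) (i≢p (s≤s z≤n)) e)

-- Block decompositions.

-- A block form with a = ℓ₁ - 1, m = b - a = ℓ₂ and k = c - b = ℓ₃; the entries
-- are those of Defs.BlockForm, but m and k may be 0.
record Block (ω : Permutation′ n) (a m k : ℕ) : Set where
  field
    block₁ : ∀ {i} → i < a → Entry ω i i
    block₂ : ∀ {t} → t < k → Entry ω (a + t) (a + m + t)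
    block₃ : ∀ {t} → t < m → Entry ω (a + k + t) (a + t)
    block₄ : ∀ {i} → a + k + m ≤ i → i < n → Entry ω i i

open Block

module _ {n} {ω : Permutation′ n} (F : BlockForm ω) where
  open BlockForm F using (a; b; c; a<b; b<c; c≤n)
  private module F = BlockForm F

  block-end : a + (c ∸ b) + (b ∸ a) ≡ c
  block-end = begin
    a + (c ∸ b) + (b ∸ a)    ≡⟨ rearrange a (c ∸ b) (b ∸ a) ⟩
    c ∸ b + (b ∸ a + a)      ≡⟨ cong (c ∸ b +_) (m∸n+n≡m (<⇒≤ a<b)) ⟩
    c ∸ b + b                ≡⟨ m∸n+n≡m (<⇒≤ b<c) ⟩
    c                        ∎
    where
    open ≡-Reasoning
    rearrange : ∀ a k m → a + k + m ≡ k + (m + a)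
    rearrange = solve-∀

  blockForm⇒block : Block ω a (b ∸ a) (c ∸ b)
  blockForm⇒block = record
    { block₁ = λ i<a → entry (<-≤-trans i<a (≤-trans (<⇒≤ a<b) b≤n)) λ l l≡i →
        trans (F.block₁ l (subst (ℕ._< a) (sym l≡i) i<a)) l≡i
    ; block₂ = λ {t} t<c∸b → entry (<-≤-trans (+-monoʳ-< a t<c∸b) p≤n) λ l l≡i →
        +-cancelʳ-≡ a _ _ (begin
          toℕ (ω ⟨$⟩ʳ l) + a     ≡⟨ F.block₂ l (subst (a ≤_) (sym l≡i) (m≤m+n a t))
                                      (subst (ℕ._< a + (c ∸ b)) (sym l≡i) (+-monoʳ-< a t<c∸b)) ⟩
          toℕ l + b              ≡⟨ cong₂ _+_ l≡i (sym a+m≡b) ⟩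
          a + t + (a + (b ∸ a))  ≡⟨ rearrange₂ a t (b ∸ a) ⟩
          a + (b ∸ a) + t + a    ∎)
    ; block₃ = λ {t} t<b∸a → entry (<-≤-trans (+-monoʳ-< (a + (c ∸ b)) t<b∸a) last≤n) λ l l≡i →
        +-cancelʳ-≡ c _ _ (begin
          toℕ (ω ⟨$⟩ʳ l) + c     ≡⟨ F.block₃ l (subst (a + (c ∸ b) ≤_) (sym l≡i) (m≤m+n _ t))
                                      (subst₂ ℕ._<_ (sym l≡i) block-end
                                        (+-monoʳ-< (a + (c ∸ b)) t<b∸a)) ⟩
          toℕ l + b              ≡⟨ cong (_+ b) l≡i ⟩
          a + (c ∸ b) + t + b    ≡⟨ rearrange₃ a (c ∸ b) t b ⟩
          a + t + (c ∸ b + b)    ≡⟨ cong (a + t +_) (m∸n+n≡m (<⇒≤ b<c)) ⟩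
          a + t + c              ∎)
    ; block₄ = λ {i} c≤i i<n → entry i<n λ l l≡i →
        trans (F.block₄ l (subst₂ _≤_ block-end (sym l≡i) c≤i)) l≡i
    }
    where
    open ≡-Reasoning
    entry : ∀ {i v} → i < n → (∀ l → toℕ l ≡ i → toℕ (ω ⟨$⟩ʳ l) ≡ v) → Entry ω i v
    entry i<n value = fromℕ< i<n , toℕ-fromℕ< i<n , value _ (toℕ-fromℕ< i<n)
    rearrange₂ : ∀ a t m → a + t + (a + m) ≡ a + m + t + a
    rearrange₂ = solve-∀
    rearrange₃ : ∀ a k t b → a + k + t + b ≡ a + t + (k + b)
    rearrange₃ = solve-∀
    a+m≡b : a + (b ∸ a) ≡ b
    a+m≡b = m+[n∸m]≡n (<⇒≤ a<b)
    b≤n : b ≤ n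
    b≤n = ≤-trans (<⇒≤ b<c) c≤n
    last≤n : a + (c ∸ b) + (b ∸ a) ≤ n
    last≤n = subst (_≤ n) (sym block-end) c≤n
    p≤n : a + (c ∸ b) ≤ n
    p≤n = ≤-trans (m≤m+n _ (b ∸ a)) last≤n

private
  variable
    a m k a′ m′ k′ : ℕ

-- The four blocks cover all places; the place is located by successive offsets from the starts of
-- the second and third blocks.
block-rec : Block ω a m k → (Q : ℕ → ℕ → Set) →
  (∀ {i} → i < a → Q i i) →
  (∀ {t} → t < k → Q (a + t) (a + m + t)) →
  (∀ {t} → t < m → Q (a + k + t) (a + t)) →
  (∀ {i} → a + k + m ≤ i → i < n → Q i i) →
  (l : Fin n) → Q (toℕ l) (toℕ (ω ⟨$⟩ʳ l))
block-rec {ω = ω} {a} {m} {k} B Q q₁ q₂ q₃ q₄ l with toℕ l <? a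
... | yes l<a = entry-at ω Q (block₁ B l<a) (q₁ l<a) l refl
... | no l≮a with m≤n⇒∃[o]m+o≡n (≮⇒≥ l≮a)
...   | t , a+t≡l with t <? k
...     | yes t<k = entry-at ω Q (block₂ B t<k) (q₂ t<k) l (sym a+t≡l)
...     | no t≮k with m≤n⇒∃[o]m+o≡n (≮⇒≥ t≮k)
...       | s , k+s≡t with s <? m
...         | yes s<m = entry-at ω Q (block₃ B s<m) (q₃ s<m) l
                          (sym (trans (+-assoc a k s) (trans (cong (a +_) k+s≡t) a+t≡l)))
...         | no s≮m = entry-at ω Q (block₄ B c≤l (toℕ<n l)) (q₄ c≤l (toℕ<n l)) l refl
  where
  c≤l : a + k + m ≤ toℕ l
  c≤l = ≤-trans (+-monoʳ-≤ (a + k) (≮⇒≥ s≮m))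
          (≤-reflexive (trans (+-assoc a k s) (trans (cong (a +_) k+s≡t) a+t≡l)))

-- The parameters determine every entry, so a chain that ends in the block shape of `π` ends in `π`
-- up to `_≈_`.
block-≈ : Block ω a m k → Block π a m k → ω ≈ π
block-≈ {ω = ω} {π = π} B C l = toℕ-injective (entry-at π (λ _ v → toℕ (ω ⟨$⟩ʳ l) ≡ v)
  (block-rec B (Entry π) (block₁ C) (block₂ C) (block₃ C) (block₄ C) l) refl l refl)

-- Inversion exchanges places with values, and thereby the second block with the third.
block-flip : Block ω a m k → Block (flip ω) a k m
block-flip {ω = ω} {a} {m} {k} B = record
  { block₁ = entry-flip ω ∘ block₁ B
  ; block₂ = entry-flip ω ∘ block₃ B
  ; block₃ = entry-flip ω ∘ block₂ B
  ; block₄ = λ {i} c≤i → entry-flip ω ∘ block₄ B (subst (_≤ i) (c≡ a m k) c≤i)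
  }
  where
  c≡ : ∀ a m k → a + m + k ≡ a + k + m
  c≡ = solve-∀

-- Moving units of length between blocks.

Reaches : Permutation′ n → ℕ → ℕ → ℕ → Set
Reaches ω a m k = ∃ λ ω′ → Star _⟶_ ω ω′ × Block ω′ a m k

reaches-flip : Reaches ω a m k → Reaches (flip ω) a k m
reaches-flip (ω′ , steps , B) = flip ω′ ,
  gmap flip (λ {υ} {υ′} → flip-⟶ υ υ′) steps , block-flip B

-- The entry `a + m + k` ends at the place of its own number, where it is a fixed point and opens
-- the fourth block.
ℓ₃-to-ℓ₄ : Block ω a m (suc k) → Reaches ω a m k
ℓ₃-to-ℓ₄ {ω = ω} {a} {m} {k} B
  with slide m ω (λ t → a + k + t) (a +_) (a + m + k)
         (λ t → +-monoʳ-< (a + k) (n<1+n t))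
         (λ t<m → <-≤-trans (+-monoʳ-< a t<m) (m≤m+n _ k))
         (subst (λ i → Entry ω i (a + m + k)) (sym (+-identityʳ _)) (block₂ B (n<1+n k)))
         (λ {t} t<m → subst (λ i → Entry ω i (a + t)) (shift a k t) (block₃ B t<m))
  where
  shift : ∀ a k t → a + suc k + t ≡ a + k + suc t
  shift = solve-∀
... | ω′ , steps , y-at , x-at , frame = ω′ , steps , record
  { block₁ = λ i<a → frame (λ _ → <⇒≢ (<-≤-trans i<a (≤-trans (m≤m+n a k) (m≤m+n _ _))))
                       (block₁ B i<a)
  ; block₂ = λ t<k → frame (λ _ → <⇒≢ (<-≤-trans (+-monoʳ-< a t<k) (m≤m+n _ _)))
                       (block₂ B (m≤n⇒m≤1+n t<k))
  ; block₃ = x-at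
  ; block₄ = suffix
  }
  where
  c≡ : ∀ a m k → suc (a + k + m) ≡ a + suc k + m
  c≡ = solve-∀
  y≡ : ∀ a m k → a + m + k ≡ a + k + m
  y≡ = solve-∀
  suffix : ∀ {i} → a + k + m ≤ i → i < _ → Entry ω′ i i
  suffix {i} c≤i i<n with m≤n⇒m<n∨m≡n c≤i
  ... | inj₂ refl = subst (Entry ω′ _) (y≡ a m k) y-at
  ... | inj₁ c<i = frame (λ t≤m → >⇒≢ (≤-<-trans (+-monoʳ-≤ (a + k) t≤m) c<i))
                     (block₄ B (subst (_≤ i) (c≡ a m k) c<i) i<n)

-- The entries of the third block each move back one term along `p`. Entry `a` thus becomes fixed
-- and joins the first block, unless `m` is 0, when the moving entry is `a` itself and is already
-- fixed.
ℓ₃-to-ℓ₁ : Block ω a m (suc k) → Reaches ω (suc a) m k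
ℓ₃-to-ℓ₁ {ω = ω} {a} {m} {k} B
  with slide m ω p (a +_) (a + m) p-inc
         (+-monoʳ-< a)
         (subst₂ (Entry ω) (+-identityʳ a) (+-identityʳ (a + m)) (block₂ B (s≤s z≤n)))
         (λ {t} t<m → subst (λ i → Entry ω i (a + t)) (cong (_+ t) (+-suc a k)) (block₃ B t<m))
  module ℓ₃-to-ℓ₁ where
  -- The places jump from the first one of the second block over its other `k` places to the third
  -- block.
  p : ℕ → ℕ
  p zero    = a
  p (suc t) = suc a + k + t
  p-inc : ∀ t → p t < p (suc t)
  p-inc zero    = s≤s (≤-trans (m≤m+n a k) (m≤m+n _ 0))
  p-inc (suc t) = +-monoʳ-< (suc a + k) (n<1+n t)
... | ω′ , steps , y-at , x-at , frame = ω′ , steps , record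
  { block₁ = prefix
  ; block₂ = λ {t} t<k → frame (gap t<k)
               (subst₂ (Entry ω) (+-suc a t) (+-suc (a + m) t) (block₂ B (s≤s t<k)))
  ; block₃ = λ {t} t<m → subst (Entry ω′ _) (+-suc a t) (x-at′ {suc t} t<m)
  ; block₄ = λ {i} c≤i i<n → frame (beyond c≤i)
               (block₄ B (subst (_≤ i) (cong (_+ m) (sym (+-suc a k))) c≤i) i<n)
  }
  where
  open ℓ₃-to-ℓ₁ B using (p; p-inc)
  -- The moving entry `a + m` continues the sequence `a + t`, so the case `t = m` fits the same
  -- formula.
  x-at′ : ∀ {t} → t ≤ m → Entry ω′ (p t) (a + t)
  x-at′ t≤m with m≤n⇒m<n∨m≡n t≤m
  ... | inj₁ t<m  = x-at t<m
  ... | inj₂ refl = y-at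
  above : ∀ {i} → i < a → ∀ t → i < p t
  above i<a zero    = i<a
  above i<a (suc t) = <-trans i<a (increasing-< p-inc {t = suc t} (s≤s z≤n))
  prefix : ∀ {i} → i < suc a → Entry ω′ i i
  prefix (s≤s i≤a) with m≤n⇒m<n∨m≡n i≤a
  ... | inj₁ i<a  = frame (λ {t} _ → <⇒≢ (above i<a t)) (block₁ B i<a)
  ... | inj₂ refl = subst (Entry ω′ a) (+-identityʳ a) (x-at′ z≤n)
  gap : ∀ {s t} → s < k → t ≤ m → suc a + s ≢ p t
  gap {s} {zero}  s<k _ = >⇒≢ (s≤s (m≤m+n a s))
  gap {s} {suc t} s<k _ = <⇒≢ (<-≤-trans (+-monoʳ-< (suc a) s<k) (m≤m+n _ t))
  beyond : ∀ {i t} → suc a + k + m ≤ i → t ≤ m → i ≢ p t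
  beyond {t = zero}  c≤i _   = >⇒≢ (≤-trans (≤-trans (m≤m+n _ k) (m≤m+n _ m)) c≤i)
  beyond {t = suc t} c≤i t<m = >⇒≢ (<-≤-trans (+-monoʳ-< (suc a + k) t<m) c≤i)

ℓ₂-to-ℓ₄ : Block ω a (suc m) k → Reaches ω a m k
ℓ₂-to-ℓ₄ = reaches-flip ∘ ℓ₃-to-ℓ₄ ∘ block-flip

ℓ₂-to-ℓ₁ : Block ω a (suc m) k → Reaches ω (suc a) m k
ℓ₂-to-ℓ₁ = reaches-flip ∘ ℓ₃-to-ℓ₁ ∘ block-flip

reaches-trans : Reaches ω a m k →
  (∀ {ω₁ : Permutation′ n} → Block ω₁ a m k → Reaches ω₁ a′ m′ k′) → Reaches {n} ω a′ m′ k′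
reaches-trans (_ , steps , B) next with next B
... | ω₂ , steps′ , B′ = ω₂ , steps ◅◅ steps′ , B′

-- `r` and `s` are the surplus units of ℓ₂ and ℓ₃. Each goes to ℓ₁ until `a` reaches `a′`, and to ℓ₄
-- from then on; the upper bound on `a′` keeps the surplus from running out too early.
block-reaches : ∀ r s → a ≤ a′ → a′ ≤ a + (r + s) →
  Block ω a (r + m) (s + k) → Reaches ω a′ m k
block-reaches {a = a} zero zero a≤a′ a′≤ B
  with ≤-antisym a≤a′ (subst (_ ≤_) (+-identityʳ a) a′≤)
... | refl = _ , ε , B
block-reaches {a = a} {a′} zero (suc s) a≤a′ a′≤ B with m≤n⇒m<n∨m≡n a≤a′
... | inj₁ a<a′ = reaches-trans (ℓ₃-to-ℓ₁ B)
                    (block-reaches zero s a<a′ (subst (a′ ≤_) (+-suc a _) a′≤))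
... | inj₂ refl = reaches-trans (ℓ₃-to-ℓ₄ B) (block-reaches zero s ≤-refl (m≤m+n a _))
block-reaches {a = a} {a′} (suc r) s a≤a′ a′≤ B with m≤n⇒m<n∨m≡n a≤a′
... | inj₁ a<a′ = reaches-trans (ℓ₂-to-ℓ₁ B)
                    (block-reaches r s a<a′ (subst (a′ ≤_) (+-suc a _) a′≤))
... | inj₂ refl = reaches-trans (ℓ₂-to-ℓ₄ B) (block-reaches r s ≤-refl (m≤m+n a _))

block-≤ᴮ : Block π a′ m′ k′ → Block σ a m k →
  a ≤ a′ → a′ + k′ + m′ ≤ a + k + m → m′ ≤ m → k′ ≤ k → π ≤ᴮ σ
block-≤ᴮ {a′ = a′} {m′} {k′} {a = a} {m} {k} Bπ Bσ a≤a′ c′≤c m′≤m k′≤k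
  with block-reaches (m ∸ m′) (k ∸ k′) a≤a′ a′≤
         (subst₂ (Block _ a) (sym (m∸n+n≡m m′≤m)) (sym (m∸n+n≡m k′≤k)) Bσ)
  where
  regroup : ∀ a r s m k → a + (s + k) + (r + m) ≡ a + (r + s) + (k + m)
  regroup = solve-∀
  -- Cancelling `k′ + m′` in the inequality between the block ends shows that the total surplus
  -- covers the growth of ℓ₁.
  a′≤ : a′ ≤ a + (m ∸ m′ + (k ∸ k′))
  a′≤ = +-cancelʳ-≤ (k′ + m′) _ _ (subst₂ _≤_ (+-assoc a′ k′ m′)
          (trans (sym (cong₂ (λ x y → a + x + y) (m∸n+n≡m k′≤k) (m∸n+n≡m m′≤m)))
                 (regroup a (m ∸ m′) (k ∸ k′) m′ k′)) c′≤c)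
... | ω , steps , Bω = ω , steps , block-≈ Bω Bπ

-- Bounds inherited by all smaller permutations.

-- The first and fourth blocks enter through inequalities, since demanding `v ≡ i` there would not
-- be `SortingClosed`.
record Within (a m k i v : ℕ) : Set where
  field
    prefix-≤ : i < a → v ≤ i
    v≤i+m    : v ≤ i + m
    i≤v+k    : i ≤ v + k
    suffix-≥ : a + k + m ≤ i → i ≤ v

open Within

-- Both new pairs take their upper bounds on the value from `(i, v)` and their lower bounds from
-- `(j, u)`.
within-closed : SortingClosed (Within a m k)
within-closed {m = m} {k} i<j u<v Wiv Wju = record
  { prefix-≤ = λ i<a → ≤-trans (<⇒≤ u<v) (prefix-≤ Wiv i<a)
  ; v≤i+m    = ≤-trans (<⇒≤ u<v) (v≤i+m Wiv)
  ; i≤v+k    = ≤-trans (<⇒≤ i<j) (i≤v+k Wju)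
  ; suffix-≥ = λ c≤i → ≤-trans (<⇒≤ i<j) (suffix-≥ Wju (≤-trans c≤i (<⇒≤ i<j)))
  } , record
  { prefix-≤ = λ j<a → ≤-trans (prefix-≤ Wiv (<-trans i<j j<a)) (<⇒≤ i<j)
  ; v≤i+m    = ≤-trans (v≤i+m Wiv) (+-monoˡ-≤ m (<⇒≤ i<j))
  ; i≤v+k    = ≤-trans (i≤v+k Wju) (+-monoˡ-≤ k (<⇒≤ u<v))
  ; suffix-≥ = λ c≤j → ≤-trans (suffix-≥ Wju c≤j) (<⇒≤ u<v)
  }

block-within : Block ω a m k → ∀ l → Within a m k (toℕ l) (toℕ (ω ⟨$⟩ʳ l))
block-within {a = a} {m} {k} B = block-rec B (Within a m k)
  (λ _ → fixed)
  (λ {t} t<k → record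
    { prefix-≤ = λ a+t<a → contradiction (m≤m+n a t) (<⇒≱ a+t<a)
    ; v≤i+m    = ≤-reflexive (exchange a m t)
    ; i≤v+k    = ≤-trans (a+t≤ t) (m≤m+n _ k)
    ; suffix-≥ = λ _ → a+t≤ t
    })
  (λ {t} t<m → record
    { prefix-≤ = λ _ → +-monoˡ-≤ t (m≤m+n a k)
    ; v≤i+m    = ≤-trans (+-monoˡ-≤ t (m≤m+n a k)) (m≤m+n _ m)
    ; i≤v+k    = ≤-reflexive (exchange a k t)
    ; suffix-≥ = λ c≤i → contradiction (+-monoʳ-< (a + k) t<m) (≤⇒≯ c≤i)
    })
  (λ _ _ → fixed)
  where
  exchange : ∀ a m t → a + m + t ≡ a + t + m
  exchange = solve-∀
  a+t≤ : ∀ t → a + t ≤ a + m + t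
  a+t≤ t = +-monoˡ-≤ t (m≤m+n a m)
  fixed : ∀ {i} → Within a m k i i
  fixed = record { prefix-≤ = λ _ → ≤-refl ; v≤i+m = m≤m+n _ m
                 ; i≤v+k = m≤m+n _ k ; suffix-≥ = λ _ → ≤-refl }

-- Three entries of `π` suffice. The first of its second block exceeds its place by the whole ℓ₂,
-- the first of its third block falls short by the whole ℓ₃, and the last of its third block falls
-- short at the last place before the fourth block. Positivity of `m′` and `k′` makes these entries
-- exist and not be fixed.
within-≤ᴮ : Block π a′ m′ k′ → Block σ a m k → 0 < m′ → 0 < k′ → π ≤ᴮ σ →
  a ≤ a′ × a′ + k′ + m′ ≤ a + k + m × m′ ≤ m × k′ ≤ k
within-≤ᴮ {π = π} {a′} {suc m′} {suc k′} {σ = σ} {a = a} {m} {k} Bπ Bσ _ _ π≤σ =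
  ≮⇒≥ (λ a′<a → <⇒≱ (m<m+n a′ (s≤s z≤n)) (prefix-≤ first a′<a)) ,
  subst (_≤ a + k + m) (sym (+-suc _ m′))
    (≰⇒> λ c≤last → <⇒≱ (+-monoˡ-< m′ (m<m+n a′ (s≤s z≤n))) (suffix-≥ last c≤last)) ,
  +-cancelˡ-≤ a′ _ _ (v≤i+m first) ,
  +-cancelˡ-≤ a′ _ _ (i≤v+k middle)
  where
  within : ∀ {i v} → Entry π i v → Within a m k i v
  within (l , refl , refl) = ≤ᴮ-preserves (Within a m k) within-closed π σ π≤σ (block-within Bσ) l
  first : Within a m k a′ (a′ + suc m′)
  first = subst₂ (Within a m k) (+-identityʳ _) (+-identityʳ _) (within (block₂ Bπ (s≤s z≤n)))
  middle : Within a m k (a′ + suc k′) a′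
  middle = subst₂ (Within a m k) (+-identityʳ _) (+-identityʳ _) (within (block₃ Bπ (s≤s z≤n)))
  last : Within a m k (a′ + suc k′ + m′) (a′ + m′)
  last = within (block₃ Bπ (n<1+n m′))

-- Translation into length vectors.

theorem1p2 : (n : ℕ) → n ≥ 1 → (π σ : 𝔅 n) →
    (perm π ≤ᴮ perm σ) ⇔
    (ℓ₁ π ≥ ℓ₁ σ × ℓ₄ π ≥ ℓ₄ σ × ℓ₂ π ≤ ℓ₂ σ × ℓ₃ π ≤ ℓ₃ σ)
theorem1p2 n _ π σ = mk⇔ to from
  where
  Fπ : BlockForm (perm π)
  Fπ = blockForm (perm π) (bigrassmannian π)
  Fσ : BlockForm (perm σ)
  Fσ = blockForm (perm σ) (bigrassmannian σ)
  module P = BlockForm Fπ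

  to : perm π ≤ᴮ perm σ → ℓ₁ π ≥ ℓ₁ σ × ℓ₄ π ≥ ℓ₄ σ × ℓ₂ π ≤ ℓ₂ σ × ℓ₃ π ≤ ℓ₃ σ
  to π≤σ with within-≤ᴮ (blockForm⇒block Fπ) (blockForm⇒block Fσ)
                (m<n⇒0<n∸m P.a<b) (m<n⇒0<n∸m P.b<c) π≤σ
  ... | a≤ , c≤ , m≤ , k≤ =
    +-monoˡ-≤ 1 a≤ , ∸-monoʳ-≤ (n + 1) (subst₂ _≤_ (block-end Fπ) (block-end Fσ) c≤) , m≤ , k≤

  from : ℓ₁ π ≥ ℓ₁ σ × ℓ₄ π ≥ ℓ₄ σ × ℓ₂ π ≤ ℓ₂ σ × ℓ₃ π ≤ ℓ₃ σ → perm π ≤ᴮ perm σ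
  from (ℓ₁≥ , ℓ₄≥ , m≤ , k≤) = block-≤ᴮ (blockForm⇒block Fπ) (blockForm⇒block Fσ)
    (+-cancelʳ-≤ 1 _ _ ℓ₁≥)
    (subst₂ _≤_ (sym (block-end Fπ)) (sym (block-end Fσ))
      -- Truncated subtraction is strictly decreasing only up to its minuend, hence the use of
      -- `P.c≤n`.
      (≮⇒≥ λ c<c′ → <⇒≱ (∸-monoʳ-< c<c′ (≤-trans P.c≤n (m≤m+n n 1))) ℓ₄≥))
    m≤ k≤
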